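{- Let $G$ be a minimal DPDP-graph and let $(D,P)$ be a DP-pair in $G$. Then: (1) $D$ is a maximal independent set in $G$. (2) The induced subgraph $G[P]$ consists of independent edges, i.e., $\delta(G[P])=\Delta(G[P])=1$. (3) If $x\in P$, then $|N_G(x)\setminus P|=1$ or $N_G(x)\setminus P$ is a nonempty subset of the set $L_G$ of leaves of $G$. (4) $G$ is a 2-subdivision graph $S_2(H)$ of some graph $H$ (without isolated vertices, with respect to some function $\alpha$).
   Context: Graphs are finite and may have multiple edges and loops. A leaf is a vertex of degree one. A set $D\subseteq V(G)$ is dominating if every vertex outside $D$ has a neighbor in $D$; $P$ is paired-dominating if it is dominating and the subgraph induced by $P$ has a perfect matching. A DP-pair of $G$ is a pair $(D,P)$ of disjoint sets with $V(G)=D\cup P$, $D$ dominating and $P$ paired-dominating. A DPDP-graph is a graph with a DP-pair; a minimal DPDP-graph is a DPDP-graph no proper spanning subgraph of which is a DPDP-graph. 2-subdivision graph: for a graph $H$ with no isolated vertex, set of leaves $L_H$, and $\alpha:L_H\to\mathbb{N}=\{1,2,\dots\}$, $S_2(H)$ has vertex set $(V_H\setminus L_H)\cup\{(v,i): v\in L_H, 1\le i\le \alpha(v)\}$ together with two new vertices for each edge $e$ of $H$ ($u_e,v_e$ if $e$ joins $u\ne v$; $v_e^1,v_e^2$ if $e$ is a loop at $v$). Its edges are: the edge joining the two new vertices of each $e$; for $v\in V_H\setminus L_H$, $vv_e$ for each non-loop edge $e$ at $v$ and $vv_e^1,vv_e^2$ for each loop $e$ at $v$; for $v\in L_H$ with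 incident edge $e$, the edges $v_e(v,i)$, $1\le i\le\alpha(v)$. -}

module Defs where

open import Data.Fin.Base using (Fin; zero; suc; opposite)
open import Data.Fin.Properties using (_≟_; any?)
open import Data.Fin.Subset using (Subset; _∈_; _∉_; _⊆_; _∩_; _∪_; ∣_∣; ⊤; ⊥)
open import Data.Fin.Subset.Properties using (_∈?_)
open import Data.Nat.Base using (ℕ; _+_; _≤_)
import Data.Nat.Properties as ℕ
open import Data.Product.Base using (Σ; ∃; ∃₂; _×_; _,_)
open import Data.Sum.Base using (_⊎_)
open import Data.Vec.Base using (tabulate)
open import Function.Bundles using (_↔_; Inverse)
open import Function.Definitions using (Injective)
open import Relation.Binary.PropositionalEquality using (_≡_; _≢_)
open import Relation.Nullary.Decidable using (Dec; does; _×-dec_)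
open import Relation.Nullary.Negation using (¬_)

-- An edge e joins  end e zero  and  end e (suc zero); the order of the two
-- ends carries no meaning.  Loops and multiple edges are allowed.
record Multigraph (V E : Set) : Set where
  field
    end : E → Fin 2 → V

open Multigraph public

Graph : ℕ → ℕ → Set
Graph n m = Multigraph (Fin n) (Fin m)

private
  variable
    n m k : ℕ
    V E V′ E′ : Set

record _≅_ (G : Multigraph V E) (K : Multigraph V′ E′) : Set where
  field
    vertices : V ↔ V′
    edges    : E ↔ E′
    preserves : ∀ e →
        (∀ s → Inverse.to vertices (end G e s) ≡ end K (Inverse.to edges e) s)
      ⊎ (∀ s → Inverse.to vertices (end G e s) ≡ end K (Inverse.to edges e) (opposite s))

comprehension : {Q : Fin n → Set} → (∀ x → Dec (Q x)) → Subset n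
comprehension Q? = tabulate (λ x → does (Q? x))

module _ (G : Graph n m) where

  Incident : Fin m → Fin n → Set
  Incident e v = ∃ λ s → end G e s ≡ v

  Adjacent : Fin n → Fin n → Set
  Adjacent u v = ∃₂ λ e s → end G e s ≡ u × end G e (opposite s) ≡ v

  adjacent? : ∀ u v → Dec (Adjacent u v)
  adjacent? u v = any? λ e → any? λ s →
    (end G e s ≟ u) ×-dec (end G e (opposite s) ≟ v)

  N : Fin n → Subset n
  N x = comprehension (adjacent? x)

  edgesWithEnd : Fin 2 → Fin n → Subset m
  edgesWithEnd s v = comprehension (λ e → end G e s ≟ v)

  -- Degree of v in the subgraph with edge set F; a loop contributes 2.
  degreeIn : Subset m → Fin n → ℕ
  degreeIn F v =
    ∣ F ∩ edgesWithEnd zero v ∣ + ∣ F ∩ edgesWithEnd (suc zero) v ∣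

  degree : Fin n → ℕ
  degree = degreeIn ⊤

  Leaf : Fin n → Set
  Leaf v = degree v ≡ 1

  leaves : Subset n
  leaves = comprehension (λ v → degree v ℕ.≟ 1)

  NoIsolatedVertex : Set
  NoIsolatedVertex = ∀ v → 1 ≤ degree v

  -- Edge set of the induced subgraph G[P].
  inducedEdges : Subset n → Subset m
  inducedEdges P =
    comprehension (λ e → (end G e zero ∈? P) ×-dec (end G e (suc zero) ∈? P))

  inducedDegree : Subset n → Fin n → ℕ
  inducedDegree P = degreeIn (inducedEdges P)

  -- δ(G[P]) = d
  InducedMinDegree : Subset n → ℕ → Set
  InducedMinDegree P d =
    (∃ λ v → v ∈ P × inducedDegree P v ≡ d) × (∀ v → v ∈ P → d ≤ inducedDegree P v)

  -- Δ(G[P]) = d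
  InducedMaxDegree : Subset n → ℕ → Set
  InducedMaxDegree P d =
    (∃ λ v → v ∈ P × inducedDegree P v ≡ d) × (∀ v → v ∈ P → inducedDegree P v ≤ d)

  -- Taking u and v equal, an independent set contains no vertex with a loop.
  Independent : Subset n → Set
  Independent S = ∀ u v → u ∈ S → v ∈ S → ¬ Adjacent u v

  MaximalIndependent : Subset n → Set
  MaximalIndependent S =
    Independent S × (∀ T → Independent T → S ⊆ T → T ≡ S)

  Dominating : Subset n → Set
  Dominating D = ∀ v → v ∉ D → ∃ λ u → u ∈ D × Adjacent v u

  record PerfectMatching (P : Subset n) (M : Subset m) : Set where
    field
      induced  : M ⊆ inducedEdges P
      loopless : ∀ e → e ∈ M → end G e zero ≢ end G e (suc zero)
      disjoint : ∀ e f v → e ∈ M → f ∈ M → Incident e v → Incident f v → e ≡ f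
      covers   : ∀ v → v ∈ P → ∃ λ e → e ∈ M × Incident e v

  PairedDominating : Subset n → Set
  PairedDominating P = Dominating P × ∃ (PerfectMatching P)

  record DPPair (D P : Subset n) : Set where
    field
      disjoint   : D ∩ P ≡ ⊥
      exhaustive : D ∪ P ≡ ⊤
      dominating : Dominating D
      pairedDominating : PairedDominating P

  DPDP : Set
  DPDP = ∃₂ DPPair

record ProperSpanningSubgraph (K : Graph n k) (G : Graph n m) : Set where
  field
    embed     : Fin k → Fin m
    injective : Injective _≡_ _≡_ embed
    sameEnds  : ∀ e s → end K e s ≡ end G (embed e) s
    proper    : ∃ λ e → ∀ f → embed f ≢ e

MinimalDPDP : Graph n m → Set
MinimalDPDP {n} G =
  DPDP G × (∀ k (K : Graph n k) → ProperSpanningSubgraph K G → ¬ DPDP K)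

-- A function α : L_H → {1, 2, …}.
record LeafMultiplicity (H : Graph n m) : Set where
  field
    α        : ∀ v → .(Leaf H v) → ℕ
    positive : ∀ v .(ℓ : Leaf H v) → 1 ≤ α v ℓ

open LeafMultiplicity public

-- new e s  is the subdivision vertex v_e next to the end v = end H e s of e;
-- for a loop e at v, the two vertices new e s are v_e¹ and v_e².
data S₂-Vertex (H : Graph n m) (a : LeafMultiplicity H) : Set where
  old  : ∀ v → .(¬ Leaf H v) → S₂-Vertex H a
  copy : ∀ v → .(ℓ : Leaf H v) → Fin (α a v ℓ) → S₂-Vertex H a
  new  : Fin m → Fin 2 → S₂-Vertex H a

data S₂-Edge (H : Graph n m) (a : LeafMultiplicity H) : Set where
  middle  : Fin m → S₂-Edge H a
  spoke   : ∀ e s → .(¬ Leaf H (end H e s)) → S₂-Edge H a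
  pendant : ∀ e s → .(ℓ : Leaf H (end H e s)) → Fin (α a (end H e s) ℓ) → S₂-Edge H a

S₂ : (H : Graph n m) (a : LeafMultiplicity H) → Multigraph (S₂-Vertex H a) (S₂-Edge H a)
end (S₂ H a) (middle e)        s          = new e s
end (S₂ H a) (spoke e s ¬ℓ)    zero       = old (end H e s) ¬ℓ
end (S₂ H a) (spoke e s ¬ℓ)    (suc zero) = new e s
end (S₂ H a) (pendant e s ℓ i) zero       = copy (end H e s) ℓ i
end (S₂ H a) (pendant e s ℓ i) (suc zero) = new e s

TwoSubdivisionGraph : Graph n m → Set
TwoSubdivisionGraph G =
  ∃₂ λ n′ m′ → Σ (Graph n′ m′) λ H →
    NoIsolatedVertex H × Σ (LeafMultiplicity H) λ a → G ≅ S₂ H a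

{-# OPTIONS --safe #-}
module Submission where

-- An edge outside the matching M that is not needed for either domination can
-- be deleted.  Minimality therefore forbids edges inside D, leaves only M inside
-- P, and makes every D–P edge the only D–P edge at one of its two ends, so that
-- the D–P edges form disjoint stars, none of them trivial.  Contracting each star
-- to a vertex turns M into the edge set of the graph H.  A star with one vertex
-- in P becomes a leaf of H whose multiplicity is the number of its vertices in D;
-- a star with several vertices in P is centred at its unique vertex in D and
-- becomes a vertex of H that is not a leaf.

open import Defs
open import Data.Empty using (⊥-elim-irr)
open import Data.Fin.Base using (Fin; zero; suc; opposite; punchIn; punchOut)
open import Data.Fin.Properties using (_≟_; any?; suc-injective; opposite-involutive; punchIn-injective; punchInᵢ≢i; punchIn-punchOut)
open import Data.Fin.Subset using (Subset; _∈_; _∉_; _⊆_; _∩_; _─_; ∣_∣; ⁅_⁆; Nonempty; inside; outside)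
open import Data.Fin.Subset.Properties using (_∈?_; Empty-unique; ∣⊥∣≡0; ∣⁅x⁆∣≡1; x∈⁅x⁆; x∈⁅y⁆⇒x≡y; ⊆-antisym; ∉⊥; ∈⊤; x∈p∩q⁺; x∈p∩q⁻; x∈p∪q⁻; p─q⊆p; x∈p∧x∉q⇒x∈p─q; x∈p∧x≢y⇒x∈p-y; x∈p⇒∣p-x∣<∣p∣)
open import Data.Nat.Base using (ℕ; suc; _≤_; z≤n; s≤s)
import Data.Nat.Properties as ℕ
open import Data.Product.Base using (∃; ∃₂; _×_; _,_; proj₁; proj₂)
open import Data.Sum.Base using (_⊎_; inj₁; inj₂; [_,_]′)
open import Data.Vec.Base using (_∷_; here; there)
open import Data.Vec.Properties using (lookup⇒[]=; []=⇒lookup; lookup∘tabulate)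
open import Function.Base using (_∘_; case_of_)
open import Function.Bundles using (_↔_; Inverse; mk↔ₛ′)
open import Function.Definitions using (Injective; StrictlySurjective)
open import Relation.Binary.PropositionalEquality using (_≡_; _≢_; refl; sym; trans; cong; cong₂; subst)
open import Relation.Nullary.Decidable using (Dec; yes; no; dec-true; recompute; _×-dec_; ¬?)
open import Relation.Nullary.Negation using (¬_; contradiction)

private
  variable
    n m : ℕ

-- Finite sets

∈-comprehension⁺ : {Q : Fin n → Set} (Q? : ∀ x → Dec (Q x)) {x : Fin n} → Q x → x ∈ comprehension Q?
∈-comprehension⁺ Q? {x} q = lookup⇒[]= x _ (trans (lookup∘tabulate _ x) (dec-true (Q? x) q))

∈-comprehension⁻ : {Q : Fin n → Set} (Q? : ∀ x → Dec (Q x)) {x : Fin n} → x ∈ comprehension Q? → Q x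
∈-comprehension⁻ Q? {x} x∈ with Q? x | trans (sym (lookup∘tabulate _ x)) ([]=⇒lookup x∈)
... | yes q | _ = q
... | no _ | ()

∈─⇒∉ : (S T : Subset n) {x : Fin n} → x ∈ S ─ T → x ∉ T
∈─⇒∉ (_ ∷ _) (inside  ∷ _) () here
∈─⇒∉ (_ ∷ S) (inside  ∷ T) (there x∈) (there x∈T) = ∈─⇒∉ S T x∈ x∈T
∈─⇒∉ (_ ∷ S) (outside ∷ T) (there x∈) (there x∈T) = ∈─⇒∉ S T x∈ x∈T

element : (S : Subset n) → Fin ∣ S ∣ → Fin n
element (inside  ∷ S) zero    = zero
element (inside  ∷ S) (suc i) = suc (element S i)
element (outside ∷ S) i       = suc (element S i)

element-∈ : (S : Subset n) (i : Fin ∣ S ∣) → element S i ∈ S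
element-∈ (inside  ∷ S) zero    = here
element-∈ (inside  ∷ S) (suc i) = there (element-∈ S i)
element-∈ (outside ∷ S) i       = there (element-∈ S i)

element-injective : (S : Subset n) → Injective _≡_ _≡_ (element S)
element-injective (inside  ∷ S) {zero}  {zero}  _  = refl
element-injective (inside  ∷ S) {suc _} {suc _} eq = cong suc (element-injective S (suc-injective eq))
element-injective (outside ∷ S) eq = element-injective S (suc-injective eq)

element-surjective : (S : Subset n) {x : Fin n} → x ∈ S → ∃ λ i → element S i ≡ x
element-surjective (inside ∷ S) here = zero , refl
element-surjective (inside ∷ S) (there x∈) =
  let i , eq = element-surjective S x∈ in suc i , cong suc eq
element-surjective (outside ∷ S) (there x∈) =
  let i , eq = element-surjective S x∈ in i , cong suc eq

∈⇒1≤∣∣ : {S : Subset n} {x : Fin n} → x ∈ S → 1 ≤ ∣ S ∣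
∈⇒1≤∣∣ x∈ = ℕ.≤-trans (s≤s z≤n) (x∈p⇒∣p-x∣<∣p∣ x∈)

distinct⇒2≤∣∣ : {S : Subset n} {x y : Fin n} → x ∈ S → y ∈ S → x ≢ y → 2 ≤ ∣ S ∣
distinct⇒2≤∣∣ x∈ y∈ x≢y = ℕ.≤-trans (s≤s (∈⇒1≤∣∣ (x∈p∧x≢y⇒x∈p-y x∈ x≢y))) (x∈p⇒∣p-x∣<∣p∣ y∈)

unique⇒∣∣≡1 : {S : Subset n} {x : Fin n} → x ∈ S → (∀ {y} → y ∈ S → y ≡ x) → ∣ S ∣ ≡ 1
unique⇒∣∣≡1 {S = S} {x} x∈ unique = trans (cong ∣_∣ S≡⁅x⁆) (∣⁅x⁆∣≡1 x)
  where
  S≡⁅x⁆ : S ≡ ⁅ x ⁆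
  S≡⁅x⁆ = ⊆-antisym (λ y∈ → subst (_∈ ⁅ x ⁆) (sym (unique y∈)) (x∈⁅x⁆ x))
                    (λ y∈ → subst (_∈ S) (sym (x∈⁅y⁆⇒x≡y x y∈)) x∈)

empty⇒∣∣≡0 : {S : Subset n} → (∀ {x} → x ∉ S) → ∣ S ∣ ≡ 0
empty⇒∣∣≡0 {n} empty = trans (cong ∣_∣ (Empty-unique λ (_ , x∈) → empty x∈)) (∣⊥∣≡0 n)

-- The explicit maps run from the 2-subdivision graph to `G`, while `_≅_` asks for bijections out of
-- `G`; hence `f` becomes the inverse direction.
injective∧surjective⇒↔ : {A B : Set} (f : A → B) → Injective _≡_ _≡_ f → StrictlySurjective _≡_ f → B ↔ A
injective∧surjective⇒↔ f injective surjective =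
  mk↔ₛ′ (proj₁ ∘ surjective) f (λ x → injective (proj₂ (surjective (f x)))) (proj₂ ∘ surjective)

-- Edges and degrees

same-or-opposite : (s t : Fin 2) → t ≡ s ⊎ t ≡ opposite s
same-or-opposite zero       zero       = inj₁ refl
same-or-opposite zero       (suc zero) = inj₂ refl
same-or-opposite (suc zero) zero       = inj₂ refl
same-or-opposite (suc zero) (suc zero) = inj₁ refl

module _ (G : Graph n m) where

  -- Adjacency with the edge named: `Adjacent G u v` unfolds to `∃ λ e → Joins e u v`.
  Joins : Fin m → Fin n → Fin n → Set
  Joins e u v = ∃ λ s → end G e s ≡ u × end G e (opposite s) ≡ v

  joins-sym : ∀ {e u v} → Joins e u v → Joins e v u
  joins-sym {e} (s , eu , ev) = opposite s , ev , trans (cong (end G e) (opposite-involutive s)) eu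

  joins-ends : ∀ {e u v u′ v′} → Joins e u v → Joins e u′ v′ → (u ≡ u′ × v ≡ v′) ⊎ (u ≡ v′ × v ≡ u′)
  joins-ends (zero     , refl , refl) (zero     , refl , refl) = inj₁ (refl , refl)
  joins-ends (zero     , refl , refl) (suc zero , refl , refl) = inj₂ (refl , refl)
  joins-ends (suc zero , refl , refl) (zero     , refl , refl) = inj₂ (refl , refl)
  joins-ends (suc zero , refl , refl) (suc zero , refl , refl) = inj₁ (refl , refl)

  ∈edgesWithEnd : ∀ {F e v} s → e ∈ F → end G e s ≡ v → e ∈ F ∩ edgesWithEnd G s v
  ∈edgesWithEnd {v = v} s e∈F eq = x∈p∩q⁺ (e∈F , ∈-comprehension⁺ (λ f → end G f s ≟ v) eq)

  ∈edgesWithEnd⁻ : ∀ {F e v} s → e ∈ F ∩ edgesWithEnd G s v → e ∈ F × end G e s ≡ v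
  ∈edgesWithEnd⁻ {F} {v = v} s e∈ =
    let e∈F , e∈E = x∈p∩q⁻ F _ e∈ in e∈F , ∈-comprehension⁻ (λ f → end G f s ≟ v) e∈E

  unique-end⇒degreeIn≡1 : ∀ F {v} e s → e ∈ F → end G e s ≡ v →
    (∀ f t → f ∈ F → end G f t ≡ v → f ≡ e × t ≡ s) → degreeIn G F v ≡ 1
  unique-end⇒degreeIn≡1 F {v} e s e∈F eq unique = sum s one none
    where
    one : ∣ F ∩ edgesWithEnd G s v ∣ ≡ 1
    one = unique⇒∣∣≡1 (∈edgesWithEnd s e∈F eq) λ f∈ →
      let f∈F , feq = ∈edgesWithEnd⁻ s f∈ in proj₁ (unique _ s f∈F feq)
    none : ∀ t → t ≢ s → ∣ F ∩ edgesWithEnd G t v ∣ ≡ 0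
    none t t≢s = empty⇒∣∣≡0 λ f∈ →
      let f∈F , feq = ∈edgesWithEnd⁻ t f∈ in t≢s (proj₂ (unique _ t f∈F feq))
    sum : ∀ s → ∣ F ∩ edgesWithEnd G s v ∣ ≡ 1 → (∀ t → t ≢ s → ∣ F ∩ edgesWithEnd G t v ∣ ≡ 0) →
      degreeIn G F v ≡ 1
    sum zero       p q rewrite p | q (suc zero) (λ ()) = refl
    sum (suc zero) p q rewrite p | q zero (λ ()) = refl

  end⇒1≤degree : ∀ {v} e s → end G e s ≡ v → 1 ≤ degree G v
  end⇒1≤degree e zero       eq = ℕ.≤-trans (∈⇒1≤∣∣ (∈edgesWithEnd zero ∈⊤ eq)) (ℕ.m≤m+n _ _)
  end⇒1≤degree e (suc zero) eq = ℕ.≤-trans (∈⇒1≤∣∣ (∈edgesWithEnd (suc zero) ∈⊤ eq)) (ℕ.m≤n+m _ _)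

  -- Two different ends at `v` already give degree two: they occupy the same slot of different
  -- edges, or different slots, which includes the two ends of a loop.
  leaf⇒unique-end : ∀ {v} → Leaf G v → ∀ e s f t → end G e s ≡ v → end G f t ≡ v → e ≡ f × s ≡ t
  leaf⇒unique-end {v} leaf = ends
    where
    ¬2≤ : ¬ 2 ≤ degree G v
    ¬2≤ 2≤ = ℕ.<⇒≢ 2≤ (sym leaf)
    ends : ∀ e s f t → end G e s ≡ v → end G f t ≡ v → e ≡ f × s ≡ t
    ends e zero f zero p q with e ≟ f
    ... | yes eq = eq , refl
    ... | no e≢f = contradiction
      (ℕ.≤-trans (distinct⇒2≤∣∣ (∈edgesWithEnd zero ∈⊤ p) (∈edgesWithEnd zero ∈⊤ q) e≢f) (ℕ.m≤m+n _ _)) ¬2≤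
    ends e (suc zero) f (suc zero) p q with e ≟ f
    ... | yes eq = eq , refl
    ... | no e≢f = contradiction
      (ℕ.≤-trans (distinct⇒2≤∣∣ (∈edgesWithEnd (suc zero) ∈⊤ p) (∈edgesWithEnd (suc zero) ∈⊤ q) e≢f) (ℕ.m≤n+m _ _)) ¬2≤
    ends e zero f (suc zero) p q = contradiction
      (ℕ.+-mono-≤ (∈⇒1≤∣∣ (∈edgesWithEnd zero ∈⊤ p)) (∈⇒1≤∣∣ (∈edgesWithEnd (suc zero) ∈⊤ q))) ¬2≤
    ends e (suc zero) f zero p q = contradiction
      (ℕ.+-mono-≤ (∈⇒1≤∣∣ (∈edgesWithEnd zero ∈⊤ q)) (∈⇒1≤∣∣ (∈edgesWithEnd (suc zero) ∈⊤ p))) ¬2≤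

  ∈inducedEdges⁺ : ∀ P {e} → (∀ s → end G e s ∈ P) → e ∈ inducedEdges G P
  ∈inducedEdges⁺ P ends = ∈-comprehension⁺ (λ e → (end G e zero ∈? P) ×-dec (end G e (suc zero) ∈? P))
    (ends zero , ends (suc zero))

  ∈inducedEdges⁻ : ∀ P {e} → e ∈ inducedEdges G P → ∀ s → end G e s ∈ P
  ∈inducedEdges⁻ P e∈ s with ∈-comprehension⁻ (λ e → (end G e zero ∈? P) ×-dec (end G e (suc zero) ∈? P)) e∈ | s
  ... | p , _ | zero     = p
  ... | _ , q | suc zero = q

-- Edge deletion

_∖_ : Graph n (suc m) → Fin (suc m) → Graph n m
end (G ∖ e) f = end G (punchIn e f)

∖-properSpanning : (G : Graph n (suc m)) (e : Fin (suc m)) → ProperSpanningSubgraph (G ∖ e) G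
∖-properSpanning G e = record
  { embed     = punchIn e
  ; injective = punchIn-injective e _ _
  ; sameEnds  = λ _ _ → refl
  ; proper    = e , punchInᵢ≢i e
  }

-- Domination after deleting `e`, phrased inside `G` so that no edges have to be renumbered.
DominatingWithout : (G : Graph n m) → Fin m → Subset n → Set
DominatingWithout G e S = ∀ v → v ∉ S → ∃₂ λ u f → u ∈ S × Joins G f v u × f ≢ e

∖-dominating : (G : Graph n (suc m)) (e : Fin (suc m)) {S : Subset n} →
  DominatingWithout G e S → Dominating (G ∖ e) S
∖-dominating G e dom v v∉S =
  let u , f , u∈S , (s , fv , fu) , f≢e = dom v v∉S
      e≢f = f≢e ∘ sym
      same = λ t → cong (λ g → end G g t) (punchIn-punchOut e≢f)
  in u , u∈S , punchOut e≢f , s , trans (same s) fv , trans (same (opposite s)) fu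

∖-perfectMatching : (G : Graph n (suc m)) (e : Fin (suc m)) {P : Subset n} {M : Subset (suc m)} →
  PerfectMatching G P M → e ∉ M → ∃ (PerfectMatching (G ∖ e) P)
∖-perfectMatching G e {P} {M} PM e∉M = comprehension in? , record
  { induced  = λ f∈ → ∈inducedEdges⁺ (G ∖ e) P (∈inducedEdges⁻ G P (PM.induced (in⁻ f∈)))
  ; loopless = λ f f∈ → PM.loopless _ (in⁻ f∈)
  ; disjoint = λ f g v f∈ g∈ p q → punchIn-injective e f g (PM.disjoint _ _ v (in⁻ f∈) (in⁻ g∈) p q)
  ; covers   = covers
  }
  where
  module PM = PerfectMatching PM
  in? = λ f → punchIn e f ∈? M
  in⁻ : ∀ {f} → f ∈ comprehension in? → punchIn e f ∈ M
  in⁻ = ∈-comprehension⁻ in?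
  covers : ∀ v → v ∈ P → ∃ λ f → f ∈ comprehension in? × Incident (G ∖ e) f v
  covers v v∈P with PM.covers v v∈P
  ... | f , f∈M , s , fv =
    let e≢f = λ { refl → e∉M f∈M }
        eq = punchIn-punchOut e≢f
    in punchOut e≢f , ∈-comprehension⁺ in? (subst (_∈ M) (sym eq) f∈M)
       , s , trans (cong (λ g → end G g s) eq) fv

-- If both dominations survive the loss of `e`, then `(D , P)` is a DP-pair of `G ∖ e`, the matching
-- being intact because `e ∉ M`. Minimality enters the structure theory only through this lemma.
minimal⇒essential : (G : Graph n m) → MinimalDPDP G → ∀ {D P} → DPPair G D P →
  ∀ {M} → PerfectMatching G P M → ∀ e → e ∉ M →
  DominatingWithout G e D → ¬ DominatingWithout G e P
minimal⇒essential {m = suc _} G (_ , minimal) {D} {P} DP PM e e∉M domD domP =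
  minimal _ (G ∖ e) (∖-properSpanning G e) (D , P , record
    { disjoint         = DPPair.disjoint DP
    ; exhaustive       = DPPair.exhaustive DP
    ; dominating       = ∖-dominating G e domD
    ; pairedDominating = ∖-dominating G e domP , ∖-perfectMatching G e PM e∉M
    })

-- Simplicity of 2-subdivision graphs

-- Reduces injectivity of the edge map to that of the vertex map. Crossed ends are impossible: the
-- ends of `middle` edges carry different sides, and every other edge has a `new` vertex only as its
-- second end.
S₂-simple : {H : Graph n m} {a : LeafMultiplicity H} (e f : S₂-Edge H a) →
    (end (S₂ H a) e zero ≡ end (S₂ H a) f zero × end (S₂ H a) e (suc zero) ≡ end (S₂ H a) f (suc zero))
  ⊎ (end (S₂ H a) e zero ≡ end (S₂ H a) f (suc zero) × end (S₂ H a) e (suc zero) ≡ end (S₂ H a) f zero) →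
  e ≡ f
S₂-simple (middle _)        (middle _)        (inj₁ (refl , _))    = refl
S₂-simple (spoke _ _ _)     (spoke _ _ _)     (inj₁ (_ , refl))    = refl
S₂-simple (spoke _ _ _)     (pendant _ _ _ _) (inj₁ (() , _))
S₂-simple (pendant _ _ _ _) (spoke _ _ _)     (inj₁ (() , _))
S₂-simple (pendant _ _ _ _) (pendant _ _ _ _) (inj₁ (eq , refl)) with refl ← eq = refl
S₂-simple (middle _)        (middle _)        (inj₂ (() , _))
S₂-simple (middle _)        (spoke _ _ _)     (inj₂ (_ , ()))
S₂-simple (middle _)        (pendant _ _ _ _) (inj₂ (_ , ()))
S₂-simple (spoke _ _ _)     (middle _)        (inj₂ (() , _))
S₂-simple (spoke _ _ _)     (spoke _ _ _)     (inj₂ (() , _))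
S₂-simple (spoke _ _ _)     (pendant _ _ _ _) (inj₂ (() , _))
S₂-simple (pendant _ _ _ _) (middle _)        (inj₂ (() , _))
S₂-simple (pendant _ _ _ _) (spoke _ _ _)     (inj₂ (() , _))
S₂-simple (pendant _ _ _ _) (pendant _ _ _ _) (inj₂ (() , _))

-- Consequences of minimality

module Structure (G : Graph n m) (minimal : MinimalDPDP G) {D P : Subset n} (DP : DPPair G D P) where

  open DPPair DP using (dominating; pairedDominating)

  M : Subset m
  M = proj₁ (proj₂ pairedDominating)

  PM : PerfectMatching G P M
  PM = proj₂ (proj₂ pairedDominating)

  module PM = PerfectMatching PM

  D∩P : ∀ {x} → x ∈ D → x ∉ P
  D∩P x∈D x∈P = ∉⊥ (subst (_ ∈_) (DPPair.disjoint DP) (x∈p∩q⁺ (x∈D , x∈P)))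

  D∪P : ∀ x → x ∈ D ⊎ x ∈ P
  D∪P x = x∈p∪q⁻ D P (subst (x ∈_) (sym (DPPair.exhaustive DP)) ∈⊤)

  ∉P⇒∈D : ∀ {x} → x ∉ P → x ∈ D
  ∉P⇒∈D {x} x∉P = [ (λ x∈D → x∈D) , (λ x∈P → contradiction x∈P x∉P) ]′ (D∪P x)

  ∉D⇒∈P : ∀ {x} → x ∉ D → x ∈ P
  ∉D⇒∈P {x} x∉D = [ (λ x∈D → contradiction x∈D x∉D) , (λ x∈P → x∈P) ]′ (D∪P x)

  matching-ends : ∀ {e} → e ∈ M → ∀ s → end G e s ∈ P
  matching-ends e∈M = ∈inducedEdges⁻ G P (PM.induced e∈M)

  -- An edge by which `D` or `P` dominates an outside vertex has one end in each set, so neither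
  -- domination uses an edge inside `D`. Such an edge is not in `M` either, hence it could be
  -- deleted.
  inside-D⇒⊥ : ∀ {e u v} → Joins G e u v → u ∈ D → v ∉ D
  inside-D⇒⊥ {e} j@(s , eu , ev) u∈D v∈D = minimal⇒essential G minimal DP PM e
    (λ e∈M → D∩P u∈D (subst (_∈ P) eu (matching-ends e∈M s)))
    (λ w w∉D → let x , x∈D , f , k = dominating w w∉D in
      x , f , x∈D , k , λ { refl → case joins-ends G {f} j k of λ
        { (inj₁ (refl , _)) → w∉D u∈D ; (inj₂ (_ , refl)) → w∉D v∈D } })
    (λ w w∉P → let x , x∈P , f , k = proj₁ pairedDominating w w∉P in
      x , f , x∈P , k , λ { refl → case joins-ends G {f} j k of λ
        { (inj₁ (_ , refl)) → D∩P v∈D x∈P ; (inj₂ (refl , _)) → D∩P u∈D x∈P } })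

  -- Neither domination uses an edge inside `P`, so only membership in `M` protects it.
  inside-P⇒∈M : ∀ {e u v} → Joins G e u v → u ∈ P → v ∈ P → e ∈ M
  inside-P⇒∈M {e} j u∈P v∈P with e ∈? M
  ... | yes e∈M = e∈M
  ... | no  e∉M = contradiction
    (λ w w∉P → let x , x∈P , f , k = proj₁ pairedDominating w w∉P in
      x , f , x∈P , k , λ { refl → case joins-ends G {f} j k of λ
        { (inj₁ (refl , _)) → w∉P u∈P ; (inj₂ (_ , refl)) → w∉P v∈P } })
    (minimal⇒essential G minimal DP PM e e∉M
      (λ w w∉D → let x , x∈D , f , k = dominating w w∉D in
        x , f , x∈D , k , λ { refl → case joins-ends G {f} j k of λ
          { (inj₁ (_ , refl)) → D∩P x∈D v∈P ; (inj₂ (refl , _)) → D∩P x∈D u∈P } }))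

  PD-ends : ∀ {e p d p′ d′} → p ∈ P → d′ ∈ D → Joins G e p d → Joins G e p′ d′ → p ≡ p′ × d ≡ d′
  PD-ends {e} p∈P d′∈D j k with joins-ends G {e} j k
  ... | inj₁ eqs        = eqs
  ... | inj₂ (refl , _) = contradiction p∈P (D∩P d′∈D)

  -- If `f` is a second edge from `p` into `D` and `g` a second edge from `d` into `P`, they take
  -- over the domination of `p` and of `d`. No other vertex relies on `e`, so it could be deleted.
  star : ∀ {e f g p q d d′} → p ∈ P → q ∈ P → d ∈ D → d′ ∈ D →
    Joins G e p d → Joins G f p d′ → Joins G g q d → e ≡ f ⊎ e ≡ g
  star {e} {f} {g} {p} {q} {d} {d′} p∈P q∈P d∈D d′∈D je jf jg with e ≟ f | e ≟ g
  ... | yes e≡f | _       = inj₁ e≡f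
  ... | no _    | yes e≡g = inj₂ e≡g
  ... | no e≢f  | no e≢g  = contradiction withoutP (minimal⇒essential G minimal DP PM e e∉M withoutD)
    where
    e∉M : e ∉ M
    e∉M e∈M = D∩P d∈D (subst (_∈ P) (proj₂ (proj₂ je)) (matching-ends e∈M _))
    withoutD : DominatingWithout G e D
    withoutD w w∉D with w ≟ p
    ... | yes refl = d′ , f , d′∈D , jf , e≢f ∘ sym
    ... | no w≢p   = let x , x∈D , h , k = dominating w w∉D in
      x , h , x∈D , k , λ { refl → w≢p (proj₁ (PD-ends {h} (∉D⇒∈P w∉D) d∈D k je)) }
    withoutP : DominatingWithout G e P
    withoutP w w∉P with w ≟ d
    ... | yes refl = q , g , q∈P , joins-sym G {g} jg , e≢g ∘ sym
    ... | no w≢d   = let x , x∈P , h , k = proj₁ pairedDominating w w∉P in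
      x , h , x∈P , k , λ { refl → w≢d (proj₂ (PD-ends {h} x∈P d∈D (joins-sym G {h} k) je)) }

  -- A parallel edge would be a replacement at both ends at once.
  PD-simple : ∀ {e f p d} → p ∈ P → d ∈ D → Joins G e p d → Joins G f p d → e ≡ f
  PD-simple {e} {f} p∈P d∈D j k = [ (λ eq → eq) , (λ eq → eq) ]′ (star {e} {f} {f} p∈P p∈P d∈D d∈D j k k)

  -- Independence of D and degrees in G[P]

  D-maximalIndependent : MaximalIndependent G D
  D-maximalIndependent = (λ { u v u∈D v∈D (e , j) → inside-D⇒⊥ {e} j u∈D v∈D }) , λ T indep D⊆T → ⊆-antisym
    (λ {x} x∈T → case x ∈? D of λ
      { (yes x∈D) → x∈D
      ; (no x∉D)  → let u , u∈D , adj = dominating x x∉D in contradiction adj (indep x u x∈T (D⊆T u∈D)) })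
    D⊆T

  matching-unique : ∀ {e f} s t → e ∈ M → f ∈ M → end G e s ≡ end G f t → e ≡ f × s ≡ t
  matching-unique {e} {f} s t e∈M f∈M eq with PM.disjoint e f _ e∈M f∈M (s , refl) (t , sym eq)
  ... | refl = refl , side s t eq
    where
    side : ∀ s t → end G e s ≡ end G e t → s ≡ t
    side zero       zero       _  = refl
    side zero       (suc zero) eq = contradiction eq (PM.loopless e e∈M)
    side (suc zero) zero       eq = contradiction (sym eq) (PM.loopless e e∈M)
    side (suc zero) (suc zero) _  = refl

  -- All edges of `G[P]` lie in `M` by `inside-P⇒∈M`, so the matching edge at `v` has no competitor.
  inducedDegree≡1 : ∀ v → v ∈ P → inducedDegree G P v ≡ 1
  inducedDegree≡1 v v∈P with PM.covers v v∈P
  ... | e , e∈M , s , ev = unique-end⇒degreeIn≡1 G _ e s (PM.induced e∈M) ev λ f t f∈ fv →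
    let f∈P = ∈inducedEdges⁻ G P f∈
    in matching-unique t s (inside-P⇒∈M {f} (t , refl , refl) (f∈P t) (f∈P (opposite t))) e∈M (trans fv (sym ev))

  P-nonempty : Fin n → ∃ λ v → v ∈ P
  P-nonempty x with D∪P x
  ... | inj₁ x∈D = let u , u∈P , _ = proj₁ pairedDominating x (D∩P x∈D) in u , u∈P
  ... | inj₂ x∈P = x , x∈P

  -- The second edge `f` at `p` forbids, by `star`, a second edge from `d` into `P`; edges from `d`
  -- into `D` do not exist.
  branching⇒leaf : ∀ {e f p d d′} → p ∈ P → d ∈ D → d′ ∈ D → Joins G e p d → Joins G f p d′ → e ≢ f → Leaf G d
  branching⇒leaf {e} {f} {p} {d} p∈P d∈D d′∈D je@(s , ep , ed) jf e≢f =
    unique-end⇒degreeIn≡1 G _ e (opposite s) ∈⊤ ed λ g t _ gd → unique g t gd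
    where
    unique : ∀ g t → end G g t ≡ d → g ≡ e × t ≡ opposite s
    unique g t gd with star {e} {f} {g} p∈P (∉D⇒∈P (inside-D⇒⊥ {g} (t , gd , refl) d∈D)) d∈D d′∈D
      je jf (joins-sym G {g} (t , gd , refl))
    ... | inj₁ e≡f = contradiction e≡f e≢f
    ... | inj₂ refl with same-or-opposite s t
    ...   | inj₁ refl = contradiction p∈P (D∩P (subst (_∈ D) (trans (sym gd) ep) d∈D))
    ...   | inj₂ eq = refl , eq

  -- Chosen neighbours across the partition

  abstract
    -- Domination by `D` and domination by `P` merged into one choice of a neighbour on the other
    -- side.
    mate : ∀ x → ∃₂ λ y e → Joins G e x y × (x ∈ P × y ∈ D ⊎ x ∈ D × y ∈ P)
    mate x with D∪P x
    ... | inj₁ x∈D = let y , y∈P , e , j = proj₁ pairedDominating x (D∩P x∈D) in y , e , j , inj₂ (x∈D , y∈P)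
    ... | inj₂ x∈P = let y , y∈D , e , j = dominating x (λ x∈D → D∩P x∈D x∈P) in y , e , j , inj₁ (x∈P , y∈D)

  φ : Fin n → Fin n
  φ x = proj₁ (mate x)

  φ-edge : Fin n → Fin m
  φ-edge x = proj₁ (proj₂ (mate x))

  φ-joins : ∀ x → Joins G (φ-edge x) x (φ x)
  φ-joins x = proj₁ (proj₂ (proj₂ (mate x)))

  φ-P : ∀ {x} → x ∈ P → φ x ∈ D
  φ-P {x} x∈P with proj₂ (proj₂ (proj₂ (mate x)))
  ... | inj₁ (_ , y∈D) = y∈D
  ... | inj₂ (x∈D , _) = contradiction x∈P (D∩P x∈D)

  φ-D : ∀ {x} → x ∈ D → φ x ∈ P
  φ-D {x} x∈D with proj₂ (proj₂ (proj₂ (mate x)))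
  ... | inj₁ (x∈P , _) = contradiction x∈P (D∩P x∈D)
  ... | inj₂ (_ , y∈P) = y∈P

  -- If `x` has a neighbour outside `P` besides `φ x`, then every such neighbour is one of at least
  -- two, and `branching⇒leaf` applies to it.
  neighbours-outside-P : ∀ x → x ∈ P → ∣ N G x ─ P ∣ ≡ 1 ⊎ (Nonempty (N G x ─ P) × N G x ─ P ⊆ leaves G)
  neighbours-outside-P x x∈P with any? (λ y → (y ∈? N G x ─ P) ×-dec ¬? (y ≟ φ x))
  ... | no none = inj₁ (unique⇒∣∣≡1 φx∈ only)
    where
    φx∈ : φ x ∈ N G x ─ P
    φx∈ = x∈p∧x∉q⇒x∈p─q (∈-comprehension⁺ (adjacent? G x) (φ-edge x , φ-joins x)) (D∩P (φ-P x∈P))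
    only : ∀ {y} → y ∈ N G x ─ P → y ≡ φ x
    only {y} y∈ with y ≟ φ x
    ... | yes eq = eq
    ... | no neq = contradiction (y , y∈ , neq) none
  ... | yes (y , y∈ , y≢φx) = inj₂ ((y , y∈) , λ {z} z∈ → ∈-comprehension⁺ (λ v → degree G v ℕ.≟ 1) (leaf z∈))
    where
    in-D : ∀ {z} → z ∈ N G x ─ P → z ∈ D
    in-D z∈ = ∉P⇒∈D (∈─⇒∉ (N G x) P z∈)
    edge : ∀ {z} → z ∈ N G x ─ P → ∃ λ e → Joins G e x z
    edge z∈ = ∈-comprehension⁻ (adjacent? G x) (p─q⊆p (N G x) P z∈)
    leaf : ∀ {z} → z ∈ N G x ─ P → Leaf G z
    leaf {z} z∈ with edge z∈ | edge y∈ | z ≟ φ x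
    -- The second edge at `x` leads to `y` if `z` is `φ x`, and to `φ x` otherwise.
    ... | e , j | f , k | yes refl = branching⇒leaf {e} {f} x∈P (in-D z∈) (in-D y∈) j k
      λ { refl → y≢φx (proj₂ (PD-ends {e} x∈P (in-D z∈) k j)) }
    ... | e , j | _     | no z≢φx  = branching⇒leaf {e} {φ-edge x} x∈P (in-D z∈) (φ-P x∈P) j (φ-joins x)
      λ { refl → z≢φx (proj₂ (PD-ends {e} x∈P (φ-P x∈P) j (φ-joins x))) }

  -- A vertex of D in the star of x; it depends only on the star (c-joined).
  abstract
    c : Fin n → Fin n
    c x with x ∈? P
    ... | yes _ = φ x
    ... | no  _ = φ (φ x)

    c-P : ∀ {x} → x ∈ P → c x ≡ φ x
    c-P {x} x∈P with x ∈? P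
    ... | yes _  = refl
    ... | no x∉P = contradiction x∈P x∉P

    c-D : ∀ {x} → x ∈ D → c x ≡ φ (φ x)
    c-D {x} x∈D with x ∈? P
    ... | yes x∈P = contradiction x∈P (D∩P x∈D)
    ... | no _    = refl

  c∈D : ∀ x → c x ∈ D
  c∈D x with D∪P x
  ... | inj₁ x∈D = subst (_∈ D) (sym (c-D x∈D)) (φ-P (φ-D x∈D))
  ... | inj₂ x∈P = subst (_∈ D) (sym (c-P x∈P)) (φ-P x∈P)

  -- With `q = φ d` the claim amounts to `φ p ≡ φ q`. By `star`, either `e` is the chosen edge of
  -- `d`, and then `p` is `q`, or it is the chosen edge of `p`, and then `φ p` is `d`.
  c-joined : ∀ {e p d} → p ∈ P → d ∈ D → Joins G e p d → c p ≡ c d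
  c-joined {e} {p} {d} p∈P d∈D j = trans (c-P p∈P) (trans (φp≡φφd first) (sym (c-D d∈D)))
    where
    q = φ d
    q∈P = φ-D d∈D
    jq : Joins G (φ-edge d) q d
    jq = joins-sym G {φ-edge d} (φ-joins d)
    first : e ≡ φ-edge p ⊎ e ≡ φ-edge d
    first = star {e} {φ-edge p} {φ-edge d} p∈P q∈P d∈D (φ-P p∈P) j (φ-joins p) jq
    same : e ≡ φ-edge d → φ p ≡ φ q
    same refl = cong φ (proj₁ (PD-ends {e} p∈P d∈D j jq))
    φp≡φφd : e ≡ φ-edge p ⊎ e ≡ φ-edge d → φ p ≡ φ q
    φp≡φφd (inj₂ eq) = same eq
    -- Here `star` is applied to the edge joining `q` and `d`: either it is `e`, so that `p` is `q`
    -- again, or it is the chosen edge of `q`, so that `φ q` is `d` as well.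
    φp≡φφd (inj₁ eq) with star {φ-edge d} {φ-edge q} {e} q∈P p∈P d∈D (φ-P q∈P) jq (φ-joins q) j
    ... | inj₂ eq′ = same (sym eq′)
    ... | inj₁ eq′ = trans
      (sym (proj₂ (PD-ends {e} p∈P (φ-P p∈P) j (subst (λ f → Joins G f p (φ p)) (sym eq) (φ-joins p)))))
      (proj₂ (PD-ends {φ-edge d} q∈P (φ-P q∈P) jq (subst (λ f → Joins G f q (φ q)) (sym eq′) (φ-joins q))))

  c-φ : ∀ x → c (φ x) ≡ c x
  c-φ x = [ (λ x∈D → c-joined {φ-edge x} (φ-D x∈D) x∈D (joins-sym G {φ-edge x} (φ-joins x)))
          , (λ x∈P → sym (c-joined {φ-edge x} x∈P (φ-P x∈P) (φ-joins x))) ]′ (D∪P x)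

  -- Each `φ`-step preserves the value of `c`. Hence the fixed points of `c` are exactly its values,
  -- one for each star.
  c-idempotent : ∀ x → c (c x) ≡ c x
  c-idempotent x =
    [ (λ x∈D → trans (cong c (c-D x∈D)) (trans (c-φ (φ x)) (c-φ x)))
    , (λ x∈P → trans (cong c (c-P x∈P)) (c-φ x)) ]′ (D∪P x)

  -- If d ∈ D is not the chosen vertex, its star is centred in P.
  noncentral⇒single : ∀ {d q} → d ∈ D → c d ≢ d → q ∈ P → c q ≡ c d → q ≡ φ d
  noncentral⇒single {d} {q} d∈D c≢ q∈P cq≡cd =
    -- `star` is applied to the chosen edge of `p`. If it is the chosen edge of `d`, then `φ p` is
    -- `d`, against `c d ≢ d`; otherwise it is the chosen edge of `q`, and `q` is `p`.
    [ (λ eq → contradiction (trans (c-D d∈D) (sym (proj₂ (PD-ends {φ-edge d} p∈P (φ-P p∈P)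
                (joins-sym G {φ-edge d} (φ-joins d))
                (subst (λ f → Joins G f p (φ p)) eq (φ-joins p)))))) c≢)
    , (λ eq → proj₁ (PD-ends {φ-edge q} q∈P (φ-P p∈P) jq (subst (λ f → Joins G f p (φ p)) eq (φ-joins p)))) ]′
    (star {φ-edge p} {φ-edge d} {φ-edge q} p∈P q∈P (φ-P p∈P) d∈D (φ-joins p) (joins-sym G {φ-edge d} (φ-joins d)) jq)
    where
    p = φ d
    p∈P = φ-D d∈D
    jq : Joins G (φ-edge q) q (φ p)
    jq = subst (Joins G (φ-edge q) q) (trans (sym (c-P q∈P)) (trans cq≡cd (c-D d∈D))) (φ-joins q)

  -- The graph H

  central? : ∀ x → Dec (c x ≡ x)
  central? x = c x ≟ x

  -- One representative of each star.
  R : Subset n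
  R = comprehension central?

  abstract
    star-of : ∀ x → ∃ λ v → element R v ≡ c x
    star-of x = element-surjective R (∈-comprehension⁺ central? (c-idempotent x))

  c-element : ∀ v → c (element R v) ≡ element R v
  c-element v = ∈-comprehension⁻ central? (element-∈ R v)

  element∈D : ∀ v → element R v ∈ D
  element∈D v = subst (_∈ D) (c-element v) (c∈D _)

  hend : Fin ∣ M ∣ → Fin 2 → Fin n
  hend e s = end G (element M e) s

  hend∈P : ∀ e s → hend e s ∈ P
  hend∈P e s = matching-ends (element-∈ M e) s

  -- Together with `hend-surjective` this makes the `new` vertices a parametrization of `P`, and the
  -- ends of `H` at `v` one of the part of `P` in the star `v`.
  hend-injective : ∀ {e f s t} → hend e s ≡ hend f t → e ≡ f × s ≡ t
  hend-injective {e} {f} {s} {t} eq =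
    let p , q = matching-unique s t (element-∈ M e) (element-∈ M f) eq in element-injective M p , q

  abstract
    hend-surjective : ∀ {p} → p ∈ P → ∃₂ λ e s → hend e s ≡ p
    hend-surjective {p} p∈P with PM.covers p p∈P
    ... | e , e∈M , s , ep = let i , eq = element-surjective M e∈M in
      i , s , trans (cong (λ f → end G f s) eq) ep

  H : Graph ∣ R ∣ ∣ M ∣
  end H e s = proj₁ (star-of (hend e s))

  element-end : ∀ e s → element R (end H e s) ≡ c (hend e s)
  element-end e s = proj₂ (star-of (hend e s))

  end-of-star : ∀ {e s v} → c (hend e s) ≡ element R v → end H e s ≡ v
  end-of-star {e} {s} eq = element-injective R (trans (element-end e s) eq)

  H-noIsolated : NoIsolatedVertex H
  H-noIsolated v = let e , s , eq = hend-surjective (φ-D (element∈D v)) in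
    end⇒1≤degree H e s (end-of-star (trans (cong c eq) (trans (c-φ _) (c-element v))))

  -- By `noncentral⇒single` the star has `φ d` as its only vertex in `P`, so only one end of an edge
  -- of `H` is attached to `v`.
  noncentral⇒leaf : ∀ {d v} → d ∈ D → element R v ≡ c d → c d ≢ d → Leaf H v
  noncentral⇒leaf {d} d∈D v≡ c≢ = let e , s , eq = hend-surjective (φ-D d∈D) in
    unique-end⇒degreeIn≡1 H _ e s ∈⊤
      (end-of-star (trans (cong c eq) (trans (c-φ d) (sym v≡))))
      λ f t _ ft → hend-injective (trans
        (noncentral⇒single d∈D c≢ (hend∈P f t) (trans (sym (element-end f t)) (trans (cong (element R) ft) v≡)))
        (sym eq))

  leaf⇒single : ∀ {d} e s → Leaf H (end H e s) → d ∈ D → c d ≡ element R (end H e s) → φ d ≡ hend e s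
  leaf⇒single {d} e s leaf d∈D eq =
    let f , t , ft = hend-surjective (φ-D d∈D)
        e≡f , s≡t = leaf⇒unique-end H leaf e s f t refl (end-of-star (trans (cong c ft) (trans (c-φ d) eq)))
    in trans (sym ft) (sym (cong₂ hend e≡f s≡t))

  inStar? : ∀ v x → Dec (x ∈ D × c x ≡ element R v)
  inStar? v x = (x ∈? D) ×-dec (c x ≟ element R v)

  -- The vertices in D of the star v.
  C : Fin ∣ R ∣ → Subset n
  C v = comprehension (inStar? v)

  C-D : ∀ v i → element (C v) i ∈ D
  C-D v i = proj₁ (∈-comprehension⁻ (inStar? v) (element-∈ (C v) i))

  C-c : ∀ v i → c (element (C v) i) ≡ element R v
  C-c v i = proj₂ (∈-comprehension⁻ (inStar? v) (element-∈ (C v) i))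

  multiplicity : LeafMultiplicity H
  multiplicity = record
    { α        = λ v _ → ∣ C v ∣
    -- The representative of the star lies in `D` and is therefore counted.
    ; positive = λ v _ → ∈⇒1≤∣∣ (∈-comprehension⁺ (inStar? v) (element∈D v , c-element v))
    }

  -- The isomorphism with the 2-subdivision graph

  K : Multigraph (S₂-Vertex H multiplicity) (S₂-Edge H multiplicity)
  K = S₂ H multiplicity

  leaf? : ∀ v → Dec (Leaf H v)
  leaf? v = degree H v ℕ.≟ 1

  -- `new` covers `P`; the vertices in `D` are covered by `copy` in stars that are leaves of `H`,
  -- and by `old` in the others.
  vertex : S₂-Vertex H multiplicity → Fin n
  vertex (old v _)    = element R v
  vertex (copy v _ i) = element (C v) i
  vertex (new e s)    = hend e s

  vertex-injective : Injective _≡_ _≡_ vertex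
  vertex-injective {old v _} {old w _} eq with refl ← element-injective R eq = refl
  vertex-injective {old v ¬ℓ} {copy w ℓ i} eq
    -- The two indices agree, so one vertex of `H` would be both a leaf and not a leaf; both proofs
    -- are irrelevant, hence `⊥-elim-irr`.
    with refl ← element-injective R (trans (sym (c-element v)) (trans (cong c eq) (C-c w i))) = ⊥-elim-irr (¬ℓ ℓ)
  vertex-injective {copy w ℓ i} {old v ¬ℓ} eq
    with refl ← element-injective R (trans (sym (c-element v)) (trans (cong c (sym eq)) (C-c w i))) = ⊥-elim-irr (¬ℓ ℓ)
  vertex-injective {copy v _ i} {copy w _ j} eq
    with refl ← element-injective R (trans (sym (C-c v i)) (trans (cong c eq) (C-c w j)))
    with refl ← element-injective (C v) eq = refl
  vertex-injective {new e s} {new f t} eq with refl , refl ← hend-injective eq = refl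
  vertex-injective {old v _} {new e s} eq = contradiction (hend∈P e s) (D∩P (subst (_∈ D) eq (element∈D v)))
  vertex-injective {copy v _ i} {new e s} eq = contradiction (hend∈P e s) (D∩P (subst (_∈ D) eq (C-D v i)))
  vertex-injective {new e s} {old v _} eq = contradiction (hend∈P e s) (D∩P (subst (_∈ D) (sym eq) (element∈D v)))
  vertex-injective {new e s} {copy v _ i} eq = contradiction (hend∈P e s) (D∩P (subst (_∈ D) (sym eq) (C-D v i)))

  nonleaf⇒central : ∀ {d v} → d ∈ D → element R v ≡ c d → ¬ Leaf H v → element R v ≡ d
  nonleaf⇒central {d} d∈D v≡ ¬ℓ with c d ≟ d
  ... | yes eq = trans v≡ eq
  ... | no neq = contradiction (noncentral⇒leaf d∈D v≡ neq) ¬ℓ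

  C-surjective : ∀ {d v} → d ∈ D → element R v ≡ c d → ∃ λ i → element (C v) i ≡ d
  C-surjective {v = v} d∈D v≡ = element-surjective (C v) (∈-comprehension⁺ (inStar? v) (d∈D , sym v≡))

  vertex-surjective : StrictlySurjective _≡_ vertex
  vertex-surjective x with D∪P x
  ... | inj₂ x∈P = let e , s , eq = hend-surjective x∈P in new e s , eq
  ... | inj₁ x∈D with star-of x
  ...   | v , v≡ with leaf? v
  ...     | yes ℓ = let i , eq = C-surjective x∈D v≡ in copy v ℓ i , eq
  ...     | no ¬ℓ = old v ¬ℓ , nonleaf⇒central x∈D v≡ ¬ℓ

  -- The chosen edge of a vertex in `P` leads to the representative of its star. In a star that is a
  -- leaf, the chosen edge of each vertex in `D` leads to the only vertex in `P`.
  edge : S₂-Edge H multiplicity → Fin m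
  edge (middle e)        = element M e
  edge (spoke e s _)     = φ-edge (hend e s)
  edge (pendant e s _ i) = φ-edge (element (C (end H e s)) i)

  edge-joins : ∀ e → Joins G (edge e) (vertex (end K e zero)) (vertex (end K e (suc zero)))
  edge-joins (middle e) = zero , refl , refl
  edge-joins (spoke e s _) = joins-sym G {φ-edge (hend e s)}
    (subst (Joins G (φ-edge (hend e s)) (hend e s)) (sym (trans (element-end e s) (c-P (hend∈P e s)))) (φ-joins _))
  edge-joins (pendant e s ℓ i) =
    -- `pendant` stores its leaf proof irrelevantly; deciding the property recovers a usable one.
    subst (Joins G (φ-edge d) d) (leaf⇒single e s (recompute (leaf? (end H e s)) ℓ) (C-D _ i) (C-c _ i)) (φ-joins d)
    where d = element (C (end H e s)) i

  edge-injective : Injective _≡_ _≡_ edge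
  edge-injective {e} {f} eq with joins-ends G {edge f} (subst (λ g → Joins G g _ _) eq (edge-joins e)) (edge-joins f)
  ... | inj₁ (p , q) = S₂-simple e f (inj₁ (vertex-injective p , vertex-injective q))
  ... | inj₂ (p , q) = S₂-simple e f (inj₂ (vertex-injective p , vertex-injective q))

  -- The edge built from `p` and `d` uses a chosen edge of `G`, not `g` itself; both have the same
  -- ends, so `PD-simple` identifies them.
  PD-edge : ∀ {g p d} → p ∈ P → d ∈ D → Joins G g p d → ∃ λ e → edge e ≡ g
  PD-edge {g} {p} {d} p∈P d∈D j with hend-surjective p∈P
  ... | e , s , refl = case leaf? (end H e s) of λ
    { (yes ℓ) → let i , eq = C-surjective d∈D v≡ in pendant e s ℓ i , parallel (pendant e s ℓ i) eq refl
    ; (no ¬ℓ) → spoke e s ¬ℓ , parallel (spoke e s ¬ℓ) (nonleaf⇒central d∈D v≡ ¬ℓ) refl }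
    where
    v≡ : element R (end H e s) ≡ c d
    v≡ = trans (element-end e s) (c-joined {g} p∈P d∈D j)
    parallel : ∀ f → vertex (end K f zero) ≡ d → vertex (end K f (suc zero)) ≡ p → edge f ≡ g
    parallel f refl eq = PD-simple {edge f} {g} p∈P d∈D
      (subst (λ x → Joins G (edge f) x d) eq (joins-sym G {edge f} (edge-joins f))) j

  edge-surjective : StrictlySurjective _≡_ edge
  edge-surjective g with D∪P (end G g zero) | D∪P (end G g (suc zero))
  ... | inj₁ d | inj₁ d′ = contradiction d′ (inside-D⇒⊥ {g} (zero , refl , refl) d)
  ... | inj₁ d | inj₂ p  = PD-edge p d (suc zero , refl , refl)
  ... | inj₂ p | inj₁ d  = PD-edge p d (zero , refl , refl)
  ... | inj₂ p | inj₂ p′ =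
    let i , eq = element-surjective M (inside-P⇒∈M {g} (zero , refl , refl) p p′) in middle i , eq

  vertices : Fin n ↔ S₂-Vertex H multiplicity
  vertices = injective∧surjective⇒↔ vertex vertex-injective vertex-surjective

  edges : Fin m ↔ S₂-Edge H multiplicity
  edges = injective∧surjective⇒↔ edge edge-injective edge-surjective

  S₂-isomorphism : G ≅ K
  S₂-isomorphism = record { vertices = vertices ; edges = edges ; preserves = preserves }
    where
    to-vertex : ∀ {x y} → x ≡ vertex y → Inverse.to vertices x ≡ y
    to-vertex = Inverse.inverseˡ vertices
    preserves : ∀ e →
        (∀ s → Inverse.to vertices (end G e s) ≡ end K (Inverse.to edges e) s)
      ⊎ (∀ s → Inverse.to vertices (end G e s) ≡ end K (Inverse.to edges e) (opposite s))
    preserves e with Inverse.to edges e | Inverse.strictlyInverseʳ edges e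
    -- `e` has become `edge f`, so the orientation found by `edge-joins f` decides the alternative.
    ... | f | refl with edge-joins f
    ...   | zero     , p , q = inj₁ λ { zero → to-vertex p ; (suc zero) → to-vertex q }
    ...   | suc zero , p , q = inj₂ λ { zero → to-vertex q ; (suc zero) → to-vertex p }

theorem4p5 : ∀ (n m : ℕ) (G : Graph n m) → MinimalDPDP G →
    ∀ (D P : Subset n) → DPPair G D P →
    MaximalIndependent G D
    × (1 ≤ n → InducedMinDegree G P 1 × InducedMaxDegree G P 1)
    × (∀ x → x ∈ P → ∣ N G x ─ P ∣ ≡ 1 ⊎ (Nonempty (N G x ─ P) × N G x ─ P ⊆ leaves G))
    × TwoSubdivisionGraph G
theorem4p5 n m G minimal D P DP =
  D-maximalIndependent
  -- Both extremal degrees must be attained. From `1 ≤ n` the vertex `zero` exists, and it yields a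
  -- vertex of `P`.
  , (λ { (s≤s _) → let v , v∈P = P-nonempty zero
                       attained = v , v∈P , inducedDegree≡1 v v∈P in
         (attained , λ u u∈P → ℕ.≤-reflexive (sym (inducedDegree≡1 u u∈P)))
       , (attained , λ u u∈P → ℕ.≤-reflexive (inducedDegree≡1 u u∈P)) })
  , neighbours-outside-P
  , _ , _ , H , H-noIsolated , multiplicity , S₂-isomorphism
  where open Structure G minimal DP
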